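{- Let $G$ be a connected simple graph on $n$ vertices. Then $\mathrm{gpn}(G)\geq\binom{n+1}{2}$, with equality if and only if $G$ is a geodetic graph.
   Context: All graphs are finite, simple and connected. A geodesic between vertices $u$ and $v$ of a graph $G$ is a shortest path connecting $u$ and $v$. For distinct $u,v\in V(G)$, $\mathrm{gpn}_G(u,v)$ denotes the number of shortest $u$–$v$ paths in $G$. The geodesic subpath number of a graph $G$ on $n$ vertices is $\mathrm{gpn}(G)=\sum_{\{u,v\}\subseteq V(G),\,u\neq v}\mathrm{gpn}_G(u,v)+n$ (the sum is over unordered pairs of distinct vertices; the term $n$ counts the geodesics of length zero). A geodetic graph is a graph in which every pair of vertices is connected by exactly one geodesic. -}

module Defs where

open import Data.Fin using (Fin; zero; suc; _<?_)
open import Data.Fin.Properties using (_≟_; injective⇒≤)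
open import Data.List using (List; []; _∷_; length; head; last; map; filter; lookup; concatMap; upTo; allFin; cartesianProduct; cartesianProductWith)
open import Data.List.Membership.Propositional using (_∈_; lose)
open import Data.List.Membership.Propositional.Properties using (∈-concatMap⁺; ∈-cartesianProductWith⁺; ∈-upTo⁺; ∈-allFin; ∈-lookup)
open import Data.List.Relation.Unary.All as All using (All; all?)
open import Data.List.Relation.Unary.AllPairs using (_∷_)
open import Data.List.Relation.Unary.Any using (here)
open import Data.List.Relation.Unary.Linked using (Linked; linked?)
open import Data.List.Relation.Unary.Unique.DecPropositional using (unique?)
open import Data.List.Relation.Unary.Unique.Propositional using (Unique)
open import Data.Maybe using (just)
open import Data.Maybe.Properties using (≡-dec)
open import Data.Nat using (ℕ; zero; suc; pred; _+_; _≤_; _≤?_; s≤s)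
open import Data.Nat.ListAction using (sum)
open import Data.Product using (∃; ∃!; _×_; _,_; uncurry)
open import Level using (0ℓ)
open import Relation.Binary using (Rel; Symmetric; Irreflexive; Decidable)
open import Relation.Binary.PropositionalEquality using (_≡_; refl; cong; sym)
open import Relation.Nullary using (Dec; contradiction)
open import Relation.Nullary.Decidable using (map′; _×-dec_; _→-dec_)

-- Adjacency may be any decidable relation, not necessarily proof-irrelevant:
-- paths are lists of vertices, so distinct proofs of adjacency never count as
-- distinct paths.
record SimpleGraph (n : ℕ) : Set₁ where
  infix 4 _~_ _~?_
  field
    _~_      : Rel (Fin n) 0ℓ
    ~-sym    : Symmetric _~_
    ~-irrefl : Irreflexive _≡_ _~_
    _~?_     : Decidable _~_

-- Number of edges of a path given by its list of vertices.
pathLength : ∀ {n} → List (Fin n) → ℕ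
pathLength xs = pred (length xs)

module _ {n : ℕ} (G : SimpleGraph n) where

  open SimpleGraph G

  record IsPath (u v : Fin n) (xs : List (Fin n)) : Set where
    constructor mkIsPath
    field
      starts   : head xs ≡ just u
      ends     : last xs ≡ just v
      linked   : Linked _~_ xs
      distinct : Unique xs

  Connected : Set
  Connected = ∀ u v → ∃ (IsPath u v)

  record IsGeodesic (u v : Fin n) (xs : List (Fin n)) : Set where
    constructor mkIsGeodesic
    field
      isPath   : IsPath u v xs
      shortest : ∀ ys → IsPath u v ys → pathLength xs ≤ pathLength ys

  Geodetic : Set
  Geodetic = ∀ u v → ∃! _≡_ (IsGeodesic u v)

listsOfLength : ∀ n → ℕ → List (List (Fin n))
listsOfLength n zero    = [] ∷ []
listsOfLength n (suc k) = cartesianProductWith _∷_ (allFin n) (listsOfLength n k)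

-- Every list over Fin n of length at most n, each occurring once; every path
-- of a graph on Fin n is among them (isPath⇒∈ below).
shortLists : ∀ n → List (List (Fin n))
shortLists n = concatMap (listsOfLength n) (upTo (suc n))

∈-listsOfLength : ∀ {n} (xs : List (Fin n)) → xs ∈ listsOfLength n (length xs)
∈-listsOfLength []       = here refl
∈-listsOfLength (x ∷ xs) =
  ∈-cartesianProductWith⁺ _∷_ (∈-allFin x) (∈-listsOfLength xs)

∈-shortLists : ∀ {n} (xs : List (Fin n)) → length xs ≤ n → xs ∈ shortLists n
∈-shortLists {n} xs l≤n =
  ∈-concatMap⁺ (listsOfLength n) (lose (∈-upTo⁺ (s≤s l≤n)) (∈-listsOfLength xs))

lookup-injective : ∀ {n} {xs : List (Fin n)} → Unique xs →
                   ∀ {i j} → lookup xs i ≡ lookup xs j → i ≡ j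
lookup-injective (x∉ ∷ u) {zero}  {zero}  eq = refl
lookup-injective {xs = _ ∷ xs} (x∉ ∷ u) {zero} {suc j} eq =
  contradiction eq (All.lookup x∉ (∈-lookup j))
lookup-injective {xs = _ ∷ xs} (x∉ ∷ u) {suc i} {zero} eq =
  contradiction (sym eq) (All.lookup x∉ (∈-lookup i))
lookup-injective (x∉ ∷ u) {suc i} {suc j} eq = cong suc (lookup-injective u eq)

module _ {n : ℕ} (G : SimpleGraph n) where

  open SimpleGraph G

  isPath⇒∈ : ∀ {u v xs} → IsPath G u v xs → xs ∈ shortLists n
  isPath⇒∈ {xs = xs} p =
    ∈-shortLists xs (injective⇒≤ (lookup-injective (IsPath.distinct p)))

  isPath? : ∀ u v xs → Dec (IsPath G u v xs)
  isPath? u v xs =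
    map′ (λ (s , e , l , d) → mkIsPath s e l d)
         (λ (mkIsPath s e l d) → s , e , l , d)
         (≡-dec _≟_ (head xs) (just u) ×-dec ≡-dec _≟_ (last xs) (just v)
           ×-dec linked? _~?_ xs ×-dec unique? _≟_ xs)

  isGeodesic? : ∀ u v xs → Dec (IsGeodesic G u v xs)
  isGeodesic? u v xs =
    map′ (λ (p , s) → mkIsGeodesic p (λ ys q → All.lookup s (isPath⇒∈ q) q))
         (λ (mkIsGeodesic p s) → p , All.tabulate (λ {ys} _ → s ys))
         (isPath? u v xs ×-dec
           all? (λ ys → isPath? u v ys →-dec (pathLength xs ≤? pathLength ys))
                (shortLists n))

  gpnBetween : Fin n → Fin n → ℕ
  gpnBetween u v = length (filter (isGeodesic? u v) (shortLists n))

  -- An unordered pair of distinct vertices is represented by its increasing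
  -- ordering.
  gpn : ℕ
  gpn = sum (map (uncurry gpnBetween)
                 (filter (uncurry _<?_) (cartesianProduct (allFin n) (allFin n)))) + n

{-# OPTIONS --safe #-}

-- The increasing pairs of vertices together with the n vertices number C(n + 1, 2),
-- and in a connected graph every pair contributes at least one geodesic to gpn.
-- So the bound holds, with equality exactly when every pair u < v contributes one
-- geodesic; reversal of paths carries this over to the pairs u > v, and [ u ] is
-- always the only geodesic from u to itself.

module Submission where

open import Defs
open import Data.Bool using (true; false)
open import Data.Fin as Fin using (Fin; zero; suc; _<?_)
open import Data.Fin.Properties using (<-cmp)
open import Data.List using (List; []; _∷_; [_]; _∷ʳ_; length; head; last; map; filter; reverse; upTo; allFin; tabulate; cartesianProduct; _++_)
open import Data.List.Extrema.Nat using (argmin; argmin-all; f[argmin]≤f[xs])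
open import Data.List.Membership.Propositional using (_∈_)
open import Data.List.Membership.Propositional.Properties using (∈-filter⁺; ∈-cartesianProduct⁺; ∈-cartesianProductWith⁻; ∈-allFin)
open import Data.List.Properties using (∷-injective; length-++; length-reverse; length-tabulate; map-cong; map-∘; map-tabulate; filter-++; filter-all; filter-≐; reverse-involutive; unfold-reverse)
open import Data.List.Relation.Binary.Disjoint.Propositional using (Disjoint)
open import Data.List.Relation.Binary.Permutation.Propositional using (↭-sym; ↭⇒↭ₛ)
open import Data.List.Relation.Binary.Permutation.Propositional.Properties using (↭-reverse)
import Data.List.Relation.Binary.Permutation.Setoid.Properties as Permutationₛ
open import Data.List.Relation.Unary.All as All using (All; []; _∷_)
open import Data.List.Relation.Unary.All.Properties as All using (all-filter)
open import Data.List.Relation.Unary.AllPairs as AllPairs using ([]; _∷_)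
import Data.List.Relation.Unary.AllPairs.Properties as AllPairs
open import Data.List.Relation.Unary.Any using (here)
open import Data.List.Relation.Unary.Linked as Linked using (Linked; []; [-])
import Data.List.Relation.Unary.Linked.Properties as Linked
open import Data.List.Relation.Unary.Unique.Propositional using (Unique)
import Data.List.Relation.Unary.Unique.Propositional.Properties as Unique
open import Data.Maybe using (just)
import Data.Maybe.Relation.Binary.Connected as Connected
open import Data.Nat using (ℕ; zero; suc; pred; _+_; _≤_; _≥_; z≤n; s≤s; s≤s⁻¹)
open import Data.Nat.Combinatorics using (_C_; nC1≡n; nCk+nC[k+1]≡[n+1]C[k+1])
open import Data.Nat.ListAction using (sum)
open import Data.Nat.Properties using (≤-antisym; +-mono-≤; +-monoˡ-≤; +-cancelʳ-≤; +-cancelʳ-≡; +-comm; suc-injective; module ≤-Reasoning)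
open import Data.Product using (∃; ∃!; _×_; _,_; uncurry)
open import Function using (_∘_; id)
open import Function.Bundles using (_⇔_; mk⇔)
open import Level using (0ℓ)
open import Relation.Binary as B using (Rel; Symmetric; tri<; tri≈; tri>)
open import Relation.Binary.PropositionalEquality using (_≡_; _≢_; refl; sym; trans; cong; cong₂; subst; subst₂; setoid; module ≡-Reasoning)
open import Relation.Nullary using (does; contradiction)
open import Relation.Unary using (Pred; Decidable)

-- Sums of positive terms.

module _ {A : Set} (f : A → ℕ) where

  length≤sum-map : ∀ {xs} → All (λ x → 1 ≤ f x) xs → length xs ≤ sum (map f xs)
  length≤sum-map []           = z≤n
  length≤sum-map (1≤fx ∷ 1≤f) = +-mono-≤ 1≤fx (length≤sum-map 1≤f)

  sum-map-ones : ∀ {xs} → All (λ x → f x ≡ 1) xs → sum (map f xs) ≡ length xs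
  sum-map-ones []           = refl
  sum-map-ones (fx≡1 ∷ f≡1) = cong₂ _+_ fx≡1 (sum-map-ones f≡1)

  -- The tail already sums to at least its length, so the first term has no room to exceed 1;
  -- removing it leaves the same equality for the tail.
  sum-map≡length⇒ones : ∀ {xs} → All (λ x → 1 ≤ f x) xs →
                        sum (map f xs) ≡ length xs → All (λ x → f x ≡ 1) xs
  sum-map≡length⇒ones []                       _  = []
  sum-map≡length⇒ones {x ∷ xs} (1≤fx ∷ 1≤f) eq =
    fx≡1 ∷ sum-map≡length⇒ones 1≤f
             (suc-injective (trans (cong (_+ sum (map f xs)) (sym fx≡1)) eq))
    where
    fx≡1 : f x ≡ 1
    fx≡1 = ≤-antisym (+-cancelʳ-≤ (sum (map f xs)) (f x) 1 (begin
      f x + sum (map f xs)  ≡⟨ eq ⟩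
      1 + length xs         ≤⟨ s≤s (length≤sum-map 1≤f) ⟩
      1 + sum (map f xs)    ∎)) 1≤fx
      where open ≤-Reasoning

-- Existence and uniqueness read off from the length of a filtered list.

module _ {A : Set} {P : Pred A 0ℓ} (P? : Decidable P) {xs : List A}
         (complete : ∀ {x} → P x → x ∈ xs) where

  private
    P⇒∈filter : ∀ {x} → P x → x ∈ filter P? xs
    P⇒∈filter px = ∈-filter⁺ P? (complete px) px

  ∃⇒1≤length-filter : ∃ P → 1 ≤ length (filter P? xs)
  ∃⇒1≤length-filter (x , px) with filter P? xs | P⇒∈filter px
  ... | _ ∷ _ | _ = s≤s z≤n

  length-filter≡1⇒∃! : length (filter P? xs) ≡ 1 → ∃! _≡_ P
  -- `P⇒∈filter` is abstracted as a whole function, so that after the match it puts every element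
  -- satisfying `P` into `[ x ]`.
  length-filter≡1⇒∃! eq with filter P? xs | all-filter P? xs | P⇒∈filter
  ... | x ∷ [] | px ∷ [] | only = x , px , λ py → member (only py)
    where
    member : ∀ {y} → y ∈ [ x ] → x ≡ y
    member (here y≡x) = sym y≡x

  -- Two surviving entries would both equal the witness, hence each other, which a list without
  -- repetitions forbids.
  ∃!⇒length-filter≡1 : Unique xs → ∃! _≡_ P → length (filter P? xs) ≡ 1
  ∃!⇒length-filter≡1 xs! (x , px , x≡)
    with filter P? xs | all-filter P? xs | Unique.filter⁺ P? xs! | P⇒∈filter px
  ... | _ ∷ []    | _            | _               | _ = refl
  ... | _ ∷ _ ∷ _ | py ∷ pz ∷ _ | (y≢z ∷ _) ∷ _ | _ =
    contradiction (trans (sym (x≡ py)) (x≡ pz)) y≢z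

-- The number of increasing pairs.

length-filter-map : ∀ {A B : Set} {P : Pred B 0ℓ} (P? : Decidable P) (f : A → B) xs →
                    length (filter P? (map f xs)) ≡ length (filter (P? ∘ f) xs)
length-filter-map P? f []       = refl
length-filter-map P? f (x ∷ xs) with does (P? (f x))
... | true  = cong suc (length-filter-map P? f xs)
... | false = length-filter-map P? f xs

-- Counting row by row: the product lists, for each `x` in turn, all pairs with first component `x`.
-- For `_<?_` the row counts are the values of `numberAbove`.
length-filter-cartesianProduct :
  ∀ {A B : Set} {R : B.REL A B 0ℓ} (R? : B.Decidable R) xs ys →
  length (filter (uncurry R?) (cartesianProduct xs ys)) ≡
  sum (map (λ x → length (filter (R? x) ys)) xs)
length-filter-cartesianProduct R? []       ys = refl
length-filter-cartesianProduct R? (x ∷ xs) ys = begin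
  length (filter (uncurry R?) (map (x ,_) ys ++ cartesianProduct xs ys))
    ≡⟨ cong length (filter-++ (uncurry R?) (map (x ,_) ys) _) ⟩
  length (filter (uncurry R?) (map (x ,_) ys) ++ filter (uncurry R?) (cartesianProduct xs ys))
    ≡⟨ length-++ (filter (uncurry R?) (map (x ,_) ys)) ⟩
  length (filter (uncurry R?) (map (x ,_) ys)) + length (filter (uncurry R?) (cartesianProduct xs ys))
    ≡⟨ cong₂ _+_ (length-filter-map (uncurry R?) (x ,_) ys) (length-filter-cartesianProduct R? xs ys) ⟩
  length (filter (R? x) ys) + sum (map (λ x → length (filter (R? x) ys)) xs) ∎
  where open ≡-Reasoning

increasingPairs : ∀ n → List (Fin n × Fin n)
increasingPairs n = filter (uncurry _<?_) (cartesianProduct (allFin n) (allFin n))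

numberAbove : ∀ n → Fin n → ℕ
numberAbove n i = length (filter (i <?_) (allFin n))

tail-allFin : ∀ n → tabulate {n = n} Fin.suc ≡ map Fin.suc (allFin n)
tail-allFin n = sym (map-tabulate {n = n} id Fin.suc)

numberAbove-zero : ∀ n → numberAbove (suc n) zero ≡ n
numberAbove-zero n = trans
  (cong length (filter-all (zero {n} <?_) (All.tabulate⁺ {f = Fin.suc {n}} λ _ → s≤s z≤n)))
  (length-tabulate {n = n} Fin.suc)

numberAbove-suc : ∀ n i → numberAbove (suc n) (suc i) ≡ numberAbove n i
numberAbove-suc n i = begin
  -- The entry `zero` of `allFin (suc n)` is already gone by computation, since `suc i <? zero`
  -- evaluates to a refutation.
  length (filter suc-i<? (tabulate Fin.suc))
    ≡⟨ cong (length ∘ filter suc-i<?) (tail-allFin n) ⟩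
  length (filter suc-i<? (map Fin.suc (allFin n)))
    ≡⟨ length-filter-map suc-i<? Fin.suc (allFin n) ⟩
  length (filter (suc-i<? ∘ Fin.suc) (allFin n))
    ≡⟨ cong length (filter-≐ (suc-i<? ∘ Fin.suc) (i <?_) (s≤s⁻¹ , s≤s) (allFin n)) ⟩
  length (filter (i <?_) (allFin n)) ∎
  where
  open ≡-Reasoning
  suc-i<? : Decidable {A = Fin (suc n)} (suc i Fin.<_)
  suc-i<? = suc i <?_

-- Induction along Pascal's rule: `zero` has `n`, that is `n C 1`, elements above it, and the
-- remaining elements form a shifted copy of `Fin n`.
sum-numberAbove : ∀ n → sum (map (numberAbove n) (allFin n)) ≡ n C 2
sum-numberAbove zero    = refl
sum-numberAbove (suc n) = begin
  numberAbove (suc n) zero + sum (map (numberAbove (suc n)) (tabulate Fin.suc))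
    ≡⟨ cong₂ (λ m is → m + sum (map (numberAbove (suc n)) is)) (numberAbove-zero n) (tail-allFin n) ⟩
  n + sum (map (numberAbove (suc n)) (map Fin.suc (allFin n)))
    ≡⟨ cong (λ ms → n + sum ms) (trans (sym (map-∘ (allFin n))) (map-cong (numberAbove-suc n) (allFin n))) ⟩
  n + sum (map (numberAbove n) (allFin n))
    ≡⟨ cong₂ _+_ (sym (nC1≡n n)) (sum-numberAbove n) ⟩
  n C 1 + n C 2
    ≡⟨ nCk+nC[k+1]≡[n+1]C[k+1] n 1 ⟩
  suc n C 2 ∎
  where open ≡-Reasoning

length-increasingPairs : ∀ n → length (increasingPairs n) + n ≡ (n + 1) C 2
length-increasingPairs n = begin
  length (increasingPairs n) + n
    ≡⟨ cong (_+ n) (trans (length-filter-cartesianProduct _<?_ (allFin n) (allFin n)) (sum-numberAbove n)) ⟩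
  n C 2 + n
    ≡⟨ +-comm (n C 2) n ⟩
  n + n C 2
    ≡⟨ cong (_+ n C 2) (nC1≡n n) ⟨
  n C 1 + n C 2
    -- Pascal's rule again: the `n` geodesics of length zero supply the term `n C 1`.
    ≡⟨ nCk+nC[k+1]≡[n+1]C[k+1] n 1 ⟩
  suc n C 2
    ≡⟨ cong (_C 2) (+-comm 1 n) ⟩
  (n + 1) C 2 ∎
  where open ≡-Reasoning

-- The enumeration of candidate paths has no repetitions.

listsOfLength-unique : ∀ n k → Unique (listsOfLength n k)
listsOfLength-unique n zero    = [] ∷ []
listsOfLength-unique n (suc k) =
  Unique.cartesianProductWith⁺ _∷_ ∷-injective (Unique.allFin⁺ n) (listsOfLength-unique n k)

∈-listsOfLength⇒length : ∀ n k {xs} → xs ∈ listsOfLength n k → length xs ≡ k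
∈-listsOfLength⇒length n zero    (here refl) = refl
∈-listsOfLength⇒length n (suc k) xs∈
  with _ , _ , _ , ys∈ , refl ← ∈-cartesianProductWith⁻ _∷_ (allFin n) (listsOfLength n k) xs∈
  = cong suc (∈-listsOfLength⇒length n k ys∈)

-- Each block of fixed length is free of repetitions, and blocks for different lengths share no
-- list. Hence `gpnBetween` counts no geodesic twice.
shortLists-unique : ∀ n → Unique (shortLists n)
shortLists-unique n = Unique.concat⁺
  (All.map⁺ (All.universal (listsOfLength-unique n) (upTo (suc n))))
  (AllPairs.map⁺ (AllPairs.map disjoint (Unique.upTo⁺ (suc n))))
  where
  disjoint : ∀ {j k} → j ≢ k → Disjoint (listsOfLength n j) (listsOfLength n k)
  disjoint j≢k (xs∈j , xs∈k) = j≢k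
    (trans (sym (∈-listsOfLength⇒length n _ xs∈j)) (∈-listsOfLength⇒length n _ xs∈k))

-- Reversal of lists.

module _ {A : Set} where

  last-∷ʳ : ∀ xs (x : A) → last (xs ∷ʳ x) ≡ just x
  last-∷ʳ []           x = refl
  last-∷ʳ (_ ∷ [])     x = refl
  last-∷ʳ (_ ∷ y ∷ xs) x = last-∷ʳ (y ∷ xs) x

  last-reverse : ∀ (xs : List A) → last (reverse xs) ≡ head xs
  last-reverse []       = refl
  last-reverse (x ∷ xs) = trans (cong last (unfold-reverse x xs)) (last-∷ʳ (reverse xs) x)

  head-reverse : ∀ (xs : List A) → head (reverse xs) ≡ last xs
  head-reverse xs = trans (sym (last-reverse (reverse xs))) (cong last (reverse-involutive xs))

  -- The head moves to the end behind the reversed tail. The link at the junction is the original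
  -- first link, turned round by symmetry.
  linked-reverse : ∀ {R : Rel A 0ℓ} → Symmetric R → ∀ {xs} → Linked R xs → Linked R (reverse xs)
  linked-reverse         R-sym {[]}     _   = []
  linked-reverse {R = R} R-sym {x ∷ xs} Rxs =
    subst (Linked R) (sym (unfold-reverse x xs))
      (Linked.++⁺ (linked-reverse R-sym (Linked.tail Rxs))
        (subst (λ y → Connected.Connected R y (just x)) (sym (last-reverse xs))
          (Connected.sym R-sym (Linked.head′ Rxs)))
        [-])

  unique-reverse : ∀ {xs : List A} → Unique xs → Unique (reverse xs)
  unique-reverse {xs} =
    Permutationₛ.Unique-resp-↭ (setoid A) (↭⇒↭ₛ (↭-sym (↭-reverse xs)))

-- Geodesics and their number.

module _ {n : ℕ} (G : SimpleGraph n) where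

  open SimpleGraph G

  reverse-isPath : ∀ {u v xs} → IsPath G u v xs → IsPath G v u (reverse xs)
  reverse-isPath {xs = xs} (mkIsPath starts ends linked distinct) = mkIsPath
    (trans (head-reverse xs) ends)
    (trans (last-reverse xs) starts)
    (linked-reverse ~-sym linked)
    (unique-reverse distinct)

  reverse-isGeodesic : ∀ {u v xs} → IsGeodesic G u v xs → IsGeodesic G v u (reverse xs)
  reverse-isGeodesic {xs = xs} (mkIsGeodesic isPath shortest) = mkIsGeodesic
    (reverse-isPath isPath)
    -- A competitor `ys` from `v` to `u` is reversed to compete with `xs`; reversal changes neither
    -- length.
    λ ys q → subst₂ (λ k l → pred k ≤ pred l) (sym (length-reverse xs)) (length-reverse ys)
      (shortest (reverse ys) (reverse-isPath q))

  -- Reversal, being an involution, matches the geodesics in the two directions one to one.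
  ∃!-geodesic-sym : ∀ {u v} → ∃! _≡_ (IsGeodesic G u v) → ∃! _≡_ (IsGeodesic G v u)
  ∃!-geodesic-sym (xs , g , xs≡) = reverse xs , reverse-isGeodesic g ,
    λ {ys} h → trans (cong reverse (xs≡ (reverse-isGeodesic h))) (reverse-involutive ys)

  ∃!-geodesic-refl : ∀ u → ∃! _≡_ (IsGeodesic G u u)
  ∃!-geodesic-refl u = [ u ] , mkIsGeodesic trivial (λ _ _ → z≤n) , unique
    where
    trivial : IsPath G u u [ u ]
    trivial = mkIsPath refl refl [-] ([] ∷ [])

    unique : ∀ {ys} → IsGeodesic G u u ys → [ u ] ≡ ys
    unique {_ ∷ []}    (mkIsGeodesic (mkIsPath refl _ _ _) _) = refl
    -- With two or more vertices the length is positive, so `[ u ]`, of length 0, is strictly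
    -- shorter.
    unique {_ ∷ _ ∷ _} (mkIsGeodesic _ shortest)              with () ← shortest [ u ] trivial

  -- All paths from `u` to `v` lie in one finite list, so one of minimal length can be chosen.
  path⇒geodesic : ∀ {u v} → ∃ (IsPath G u v) → ∃ (IsGeodesic G u v)
  path⇒geodesic {u} {v} (xs , p) =
    -- The given path `xs` is the default value of `argmin`; as it is itself a path, the result is a
    -- path in every case.
    argmin pathLength xs paths , mkIsGeodesic
      (argmin-all pathLength p (all-filter (isPath? G u v) (shortLists n)))
      λ ys q → All.lookup (f[argmin]≤f[xs] xs paths) (∈-filter⁺ (isPath? G u v) (isPath⇒∈ G q) q)
    where
    paths : List (List (Fin n))
    paths = filter (isPath? G u v) (shortLists n)

  module _ {u v : Fin n} where

    private
      geodesic⇒∈ : ∀ {xs} → IsGeodesic G u v xs → xs ∈ shortLists n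
      geodesic⇒∈ = isPath⇒∈ G ∘ IsGeodesic.isPath

    connected⇒1≤gpnBetween : Connected G → 1 ≤ gpnBetween G u v
    connected⇒1≤gpnBetween conn =
      ∃⇒1≤length-filter (isGeodesic? G u v) geodesic⇒∈ (path⇒geodesic (conn u v))

    gpnBetween≡1⇒∃! : gpnBetween G u v ≡ 1 → ∃! _≡_ (IsGeodesic G u v)
    gpnBetween≡1⇒∃! = length-filter≡1⇒∃! (isGeodesic? G u v) geodesic⇒∈

    ∃!⇒gpnBetween≡1 : ∃! _≡_ (IsGeodesic G u v) → gpnBetween G u v ≡ 1
    ∃!⇒gpnBetween≡1 = ∃!⇒length-filter≡1 (isGeodesic? G u v) geodesic⇒∈ (shortLists-unique n)

  increasing⇒geodetic : (∀ {u v} → u Fin.< v → ∃! _≡_ (IsGeodesic G u v)) → Geodetic G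
  increasing⇒geodetic unique u v with <-cmp u v
  ... | tri< u<v _ _  = unique u<v
  ... | tri≈ _ refl _ = ∃!-geodesic-refl u
  ... | tri> _ _ v<u  = ∃!-geodesic-sym (unique v<u)

mainTheorem1 : ∀ (n : ℕ) (G : SimpleGraph n) → Connected G →
    (gpn G ≥ (n + 1) C 2) × (gpn G ≡ (n + 1) C 2 ⇔ Geodetic G)
mainTheorem1 n G conn = bound , mk⇔ to from
  where
  f : Fin n × Fin n → ℕ
  f = uncurry (gpnBetween G)

  1≤f : All (λ p → 1 ≤ f p) (increasingPairs n)
  1≤f = All.universal (λ _ → connected⇒1≤gpnBetween G conn) (increasingPairs n)

  bound : gpn G ≥ (n + 1) C 2
  bound = subst (_≤ gpn G) (length-increasingPairs n) (+-monoˡ-≤ n (length≤sum-map f 1≤f))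

  to : gpn G ≡ (n + 1) C 2 → Geodetic G
  to eq = increasing⇒geodetic G λ {u} {v} u<v → gpnBetween≡1⇒∃! G
    (All.lookup ones (∈-filter⁺ (uncurry _<?_) (∈-cartesianProduct⁺ (∈-allFin u) (∈-allFin v)) u<v))
    where
    ones : All (λ p → f p ≡ 1) (increasingPairs n)
    -- Cancelling the summand `n` on both sides leaves the sum over the increasing pairs equal to
    -- their number.
    ones = sum-map≡length⇒ones f 1≤f
      (+-cancelʳ-≡ n _ _ (trans eq (sym (length-increasingPairs n))))

  from : Geodetic G → gpn G ≡ (n + 1) C 2
  from geodetic = trans
    (cong (_+ n) (sum-map-ones f
      (All.universal (λ (u , v) → ∃!⇒gpnBetween≡1 G (geodetic u v)) (increasingPairs n))))
    (length-increasingPairs n)
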